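{- For all $P,Q\in C_A$, $\mathrm{CP}_{mem}\vdash P=Q$ if and only if $P=_{mse}Q$, i.e. if and only if $mse(P)=mse(Q)$.
   Context: Let $A$ be a countable set (of atoms) with at least two elements. $C_A$ is the set of closed terms (conditional statements) over the signature with constants $T$, $F$, a constant $a$ for each $a\in A$, and one ternary operation $x\triangleleft y\triangleright z$ (the conditional, "if $y$ then $x$ else $z$"). $\mathrm{CP}$ is the set of equational axioms (in variables $x,y,z,u,v$): (CP1) $x\triangleleft T\triangleright y=x$; (CP2) $x\triangleleft F\triangleright y=y$; (CP3) $T\triangleleft x\triangleright F=x$; (CP4) $x\triangleleft(y\triangleleft z\triangleright u)\triangleright v=(x\triangleleft y\triangleright v)\triangleleft z\triangleright(x\triangleleft u\triangleright v)$. $\mathrm{CP}_{mem}$ is $\mathrm{CP}$ extended with the axiom (CPmem) $x\triangleleft y\triangleright(z\triangleleft u\triangleright(v\triangleleft y\triangleright w))=x\triangleleft y\triangleright(z\triangleleft u\triangleright w)$. For a set $E$ of equational axioms, $E\vdash s=t$ means derivability in equational logic from $E$. Evaluation trees: the set $\mathcal T_A$ is defined inductively by $T\in\mathcal T_A$, $F\in\mathcal T_A$, and $(X\trianglelefteq a\trianglerighteq Y)\in\mathcal T_A$ for all $X,Y\in\mathcal T_A$, $a\in A$ (binary tree with root $a$, left branch $X$, right branch $Y$). Leaf replacement: for $Y,Z\in\mathcal T_A$, $X[T\mapsto Y,F\mapsto Z]$ is defined by $T[T\mapsto Y,F\mapsto Z]=Y$, $F[T\mapsto Y,F\mapsto Z]=Z$,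 $(X_1\trianglelefteq a\trianglerighteq X_2)[T\mapsto Y,F\mapsto Z]=X_1[T\mapsto Y,F\mapsto Z]\trianglelefteq a\trianglerighteq X_2[T\mapsto Y,F\mapsto Z]$. The short-circuit evaluation function $se:C_A\to\mathcal T_A$ is defined by $se(T)=T$, $se(F)=F$, $se(a)=T\trianglelefteq a\trianglerighteq F$ for $a\in A$, and $se(P\triangleleft Q\triangleright R)=se(Q)[T\mapsto se(P),F\mapsto se(R)]$. Memorizing evaluation trees: for $a\in A$ define $L_a,R_a:\mathcal T_A\to\mathcal T_A$ by $L_a(B)=R_a(B)=B$ for $B\in\{T,F\}$; $L_a(X\trianglelefteq a\trianglerighteq Y)=L_a(X)$; $R_a(X\trianglelefteq a\trianglerighteq Y)=R_a(Y)$; and, if $b\neq a$, $L_a(X\trianglelefteq b\trianglerighteq Y)=L_a(X)\trianglelefteq b\trianglerighteq L_a(Y)$ and $R_a(X\trianglelefteq b\trianglerighteq Y)=R_a(X)\trianglelefteq b\trianglerighteq R_a(Y)$. Define $m:\mathcal T_A\to\mathcal T_A$ (by recursion on depth) by $m(T)=T$, $m(F)=F$, $m(X\trianglelefteq a\trianglerighteq Y)=m(L_a(X))\trianglelefteq a\trianglerighteq m(R_a(Y))$. Then $mse:C_A\to\mathcal T_A$ is $mse(P)=m(se(P))$, and memorizing valuation congruence is: $P=_{mse}Q$ iff $mse(P)=mse(Q)$. -}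

module Defs where

open import Level using (_⊔_)
open import Data.Empty using (⊥)
open import Data.Nat using (ℕ; suc; _≤_; _<_; s≤s; z≤n) renaming (_⊔_ to _⊔ⁿ_)
open import Data.Nat.Properties using (≤-trans; m≤n⇒m≤1+n; ⊔-mono-≤; m≤m⊔n; m≤n⊔m)
open import Data.Nat.Induction using (<-wellFounded)
open import Induction.WellFounded using (Acc; acc)
open import Relation.Binary.Core using (Rel)
open import Relation.Binary.Definitions using (DecidableEquality)
open import Relation.Binary.PropositionalEquality using (_≡_; refl; cong₂)
open import Relation.Nullary using (yes; no)

-- Terms with atoms in A and variables in V.
-- x ◁ y ▷ z reads "if y then x else z": the condition is in the middle.
data Term {ℓ v} (A : Set ℓ) (V : Set v) : Set (ℓ ⊔ v) where
  var   : V → Term A V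
  T F   : Term A V
  atom  : A → Term A V
  _◁_▷_ : Term A V → Term A V → Term A V → Term A V

Closed : ∀ {ℓ} → Set ℓ → Set ℓ
Closed A = Term A ⊥

Open : ∀ {ℓ} → Set ℓ → Set ℓ
Open A = Term A ℕ

module _ {ℓ} {A : Set ℓ} where

  infixl 10 _⟪_⟫
  _⟪_⟫ : ∀ {v w} {V : Set v} {W : Set w} → Term A V → (V → Term A W) → Term A W
  var x       ⟪ σ ⟫ = σ x
  T           ⟪ σ ⟫ = T
  F           ⟪ σ ⟫ = F
  atom a      ⟪ σ ⟫ = atom a
  (s ◁ t ▷ u) ⟪ σ ⟫ = (s ⟪ σ ⟫) ◁ (t ⟪ σ ⟫) ▷ (u ⟪ σ ⟫)

  ⌜_⌝ : Closed A → Open A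
  ⌜ P ⌝ = P ⟪ (λ ()) ⟫

  infix 4 _⊢_≈_
  data _⊢_≈_ {e} (E : Rel (Open A) e) : Rel (Open A) (ℓ ⊔ e) where
    axiom   : ∀ {s t} → E s t → E ⊢ s ≈ t
    ≈-refl  : ∀ {s} → E ⊢ s ≈ s
    ≈-sym   : ∀ {s t} → E ⊢ s ≈ t → E ⊢ t ≈ s
    ≈-trans : ∀ {s t u} → E ⊢ s ≈ t → E ⊢ t ≈ u → E ⊢ s ≈ u
    ≈-cong  : ∀ {s s′ t t′ u u′} → E ⊢ s ≈ s′ → E ⊢ t ≈ t′ → E ⊢ u ≈ u′ →
              E ⊢ s ◁ t ▷ u ≈ s′ ◁ t′ ▷ u′
    ≈-subst : ∀ {s t} (σ : ℕ → Open A) → E ⊢ s ≈ t → E ⊢ s ⟪ σ ⟫ ≈ t ⟪ σ ⟫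

  private
    x y z u v w : Open A
    x = var 0
    y = var 1
    z = var 2
    u = var 3
    v = var 4
    w = var 5

  -- Each axiom is a single equation between open terms; its instances arise
  -- through ≈-subst.
  data CP : Rel (Open A) ℓ where
    CP1 : CP (x ◁ T ▷ y) x
    CP2 : CP (x ◁ F ▷ y) y
    CP3 : CP (T ◁ x ▷ F) x
    CP4 : CP (x ◁ (y ◁ z ▷ u) ▷ v) ((x ◁ y ▷ v) ◁ z ▷ (x ◁ u ▷ v))

  data CPₘₑₘ : Rel (Open A) ℓ where
    cp    : ∀ {s t} → CP s t → CPₘₑₘ s t
    CPmem : CPₘₑₘ (x ◁ y ▷ (z ◁ u ▷ (v ◁ y ▷ w))) (x ◁ y ▷ (z ◁ u ▷ w))

data Tree {ℓ} (A : Set ℓ) : Set ℓ where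
  T F   : Tree A
  _⊴_⊵_ : Tree A → A → Tree A → Tree A

module _ {ℓ} {A : Set ℓ} where

  _[T↦_,F↦_] : Tree A → Tree A → Tree A → Tree A
  T             [T↦ Y ,F↦ Z ] = Y
  F             [T↦ Y ,F↦ Z ] = Z
  (X₁ ⊴ a ⊵ X₂) [T↦ Y ,F↦ Z ] = (X₁ [T↦ Y ,F↦ Z ]) ⊴ a ⊵ (X₂ [T↦ Y ,F↦ Z ])

  se : Closed A → Tree A
  se T           = T
  se F           = F
  se (atom a)    = T ⊴ a ⊵ F
  se (P ◁ Q ▷ R) = se Q [T↦ se P ,F↦ se R ]

  depth : Tree A → ℕ
  depth T           = 0
  depth F           = 0
  depth (X ⊴ a ⊵ Y) = suc (depth X ⊔ⁿ depth Y)

module Memorizing {ℓ} {A : Set ℓ} (_≟_ : DecidableEquality A) where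

  L : A → Tree A → Tree A
  L a T = T
  L a F = F
  L a (X ⊴ b ⊵ Y) with b ≟ a
  ... | yes _ = L a X
  ... | no  _ = L a X ⊴ b ⊵ L a Y

  R : A → Tree A → Tree A
  R a T = T
  R a F = F
  R a (X ⊴ b ⊵ Y) with b ≟ a
  ... | yes _ = R a Y
  ... | no  _ = R a X ⊴ b ⊵ R a Y

  depth-L : ∀ a X → depth (L a X) ≤ depth X
  depth-L a T = z≤n
  depth-L a F = z≤n
  depth-L a (X ⊴ b ⊵ Y) with b ≟ a
  ... | yes _ = m≤n⇒m≤1+n (≤-trans (depth-L a X) (m≤m⊔n (depth X) (depth Y)))
  ... | no  _ = s≤s (⊔-mono-≤ (depth-L a X) (depth-L a Y))

  depth-R : ∀ a X → depth (R a X) ≤ depth X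
  depth-R a T = z≤n
  depth-R a F = z≤n
  depth-R a (X ⊴ b ⊵ Y) with b ≟ a
  ... | yes _ = m≤n⇒m≤1+n (≤-trans (depth-R a Y) (m≤n⊔m (depth X) (depth Y)))
  ... | no  _ = s≤s (⊔-mono-≤ (depth-R a X) (depth-R a Y))

  L-< : ∀ X a Y → depth (L a X) < depth (X ⊴ a ⊵ Y)
  L-< X a Y = s≤s (≤-trans (depth-L a X) (m≤m⊔n (depth X) (depth Y)))

  R-< : ∀ X a Y → depth (R a Y) < depth (X ⊴ a ⊵ Y)
  R-< X a Y = s≤s (≤-trans (depth-R a Y) (m≤n⊔m (depth X) (depth Y)))

  -- Well-founded recursion on depth; the recursion equation of m is m-⊴ below.
  mAcc : (X : Tree A) → Acc _<_ (depth X) → Tree A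
  mAcc T           _        = T
  mAcc F           _        = F
  mAcc (X ⊴ a ⊵ Y) (acc rs) = mAcc (L a X) (rs (L-< X a Y)) ⊴ a ⊵ mAcc (R a Y) (rs (R-< X a Y))

  m : Tree A → Tree A
  m X = mAcc X (<-wellFounded (depth X))

  mAcc-irrelevant : ∀ X (p q : Acc _<_ (depth X)) → mAcc X p ≡ mAcc X q
  mAcc-irrelevant T           _        _        = refl
  mAcc-irrelevant F           _        _        = refl
  mAcc-irrelevant (X ⊴ a ⊵ Y) (acc rs) (acc ss) =
    cong₂ (λ X′ Y′ → X′ ⊴ a ⊵ Y′)
      (mAcc-irrelevant (L a X) (rs (L-< X a Y)) (ss (L-< X a Y)))
      (mAcc-irrelevant (R a Y) (rs (R-< X a Y)) (ss (R-< X a Y)))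

  m-⊴ : ∀ X a Y → m (X ⊴ a ⊵ Y) ≡ m (L a X) ⊴ a ⊵ m (R a Y)
  m-⊴ X a Y with <-wellFounded (depth (X ⊴ a ⊵ Y))
  ... | acc rs = cong₂ (λ X′ Y′ → X′ ⊴ a ⊵ Y′)
                   (mAcc-irrelevant (L a X) _ _) (mAcc-irrelevant (R a Y) _ _)

  mse : Closed A → Tree A
  mse P = m (se P)

  infix 4 _=mse_
  _=mse_ : Rel (Closed A) ℓ
  P =mse Q = mse P ≡ mse Q

{-# OPTIONS --safe #-}

-- Memorizing evaluation is run with a state recording the atoms seen so far
-- (mem), which is structural where m recurses on depth; m is the run from the
-- empty state.  Soundness: trees that agree in every state form a model of
-- CPₘₑₘ, since leaf replacement continues in the state in which a leaf is
-- reached.  Completeness: CP turns a closed term into the term of its tree, and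
-- CPmem with its three mirror images (obtained by negating conditions) yields
-- X ⊴ a ⊵ Y ≈ L a X ⊴ a ⊵ R a Y, so every tree is derivably equal to its
-- memorizing form.
module Submission where

open import Defs
open import Data.Bool using (Bool; true; false; if_then_else_)
open import Data.Empty using (⊥)
open import Data.List using (List; []; _∷_)
open import Data.Maybe using (Maybe; just; nothing; _<∣>_)
open import Data.Nat using (ℕ; _<_)
open import Data.Nat.Induction using (<-wellFounded)
open import Data.Nat.Properties using (eq?)
open import Data.Product using (∃₂; _×_; _,_)
open import Function.Base using (_∘_)
open import Function.Bundles using (_↣_; _⇔_; mk⇔)
open import Induction.WellFounded using (Acc; acc)
open import Relation.Binary.Bundles using (Setoid)
open import Relation.Binary.Definitions using (DecidableEquality)
open import Relation.Binary.PropositionalEquality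
  using (_≡_; _≢_; refl; sym; trans; cong; cong₂; module ≡-Reasoning)
open import Relation.Nullary using (yes; no; ⌊_⌋; contradiction)
import Relation.Binary.Reasoning.Setoid as SetoidReasoning

-- Leaf replacement and the interpretation of open terms as trees

module _ {ℓ} {A : Set ℓ} where

  []-identity : (X : Tree A) → X [T↦ T ,F↦ F ] ≡ X
  []-identity T           = refl
  []-identity F           = refl
  []-identity (X ⊴ a ⊵ Y) = cong₂ (_⊴ a ⊵_) ([]-identity X) ([]-identity Y)

  []-assoc : (X Y Z V W : Tree A) →
    (X [T↦ Y ,F↦ Z ]) [T↦ V ,F↦ W ] ≡ X [T↦ Y [T↦ V ,F↦ W ] ,F↦ Z [T↦ V ,F↦ W ] ]
  []-assoc T             Y Z V W = refl
  []-assoc F             Y Z V W = refl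
  []-assoc (X₁ ⊴ a ⊵ X₂) Y Z V W =
    cong₂ (_⊴ a ⊵_) ([]-assoc X₁ Y Z V W) ([]-assoc X₂ Y Z V W)

  -- Extends `se` to open terms, because a derivation between closed terms may pass through open
  -- ones.
  ⟦_⟧ : Open A → (ℕ → Tree A) → Tree A
  ⟦ var x ⟧     ρ = ρ x
  ⟦ T ⟧         ρ = T
  ⟦ F ⟧         ρ = F
  ⟦ atom a ⟧    ρ = T ⊴ a ⊵ F
  ⟦ s ◁ t ▷ u ⟧ ρ = ⟦ t ⟧ ρ [T↦ ⟦ s ⟧ ρ ,F↦ ⟦ u ⟧ ρ ]

  ⟦⟧-⟪⟫ : (t : Open A) (σ : ℕ → Open A) (ρ : ℕ → Tree A) →
    ⟦ t ⟪ σ ⟫ ⟧ ρ ≡ ⟦ t ⟧ (λ n → ⟦ σ n ⟧ ρ)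
  ⟦⟧-⟪⟫ (var x)  σ ρ = refl
  ⟦⟧-⟪⟫ T        σ ρ = refl
  ⟦⟧-⟪⟫ F        σ ρ = refl
  ⟦⟧-⟪⟫ (atom a) σ ρ = refl
  ⟦⟧-⟪⟫ (s ◁ t ▷ u) σ ρ
    rewrite ⟦⟧-⟪⟫ s σ ρ | ⟦⟧-⟪⟫ t σ ρ | ⟦⟧-⟪⟫ u σ ρ = refl

  -- σ is arbitrary because the absurd function in ⌜ P ⌝ depends on P, so that
  -- ⌜_⌝ does not compute to ⌜_⌝ of the subterms.
  ⟦⟧-closed : (P : Closed A) (σ : ⊥ → Open A) (ρ : ℕ → Tree A) → ⟦ P ⟪ σ ⟫ ⟧ ρ ≡ se P
  ⟦⟧-closed T        σ ρ = refl
  ⟦⟧-closed F        σ ρ = refl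
  ⟦⟧-closed (atom a) σ ρ = refl
  ⟦⟧-closed (P ◁ Q ▷ R) σ ρ
    rewrite ⟦⟧-closed P σ ρ | ⟦⟧-closed Q σ ρ | ⟦⟧-closed R σ ρ = refl

-- Memorizing evaluation from a state

module State {ℓ} {A : Set ℓ} (_≟_ : DecidableEquality A) where
  open Memorizing _≟_

  State : Set ℓ
  State = List (A × Bool)

  -- The oldest entry wins, so that extending a state never changes a value.
  lookup : State → A → Maybe Bool
  lookup []            a = nothing
  lookup ((c , b) ∷ s) a = lookup s a <∣> (if ⌊ a ≟ c ⌋ then just b else nothing)

  -- A record rather than a function type, so that `s` and `s′` can be inferred from a proof.
  infix 4 _⊆_
  record _⊆_ (s s′ : State) : Set ℓ where
    constructor extends
    field
      preserves : ∀ a {b} → lookup s a ≡ just b → lookup s′ a ≡ just b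
  open _⊆_

  ⊆-refl : ∀ {s} → s ⊆ s
  ⊆-refl = extends λ a eq → eq

  ⊆-trans : ∀ {s s′ s″} → s ⊆ s′ → s′ ⊆ s″ → s ⊆ s″
  ⊆-trans p q = extends λ a eq → preserves q a (preserves p a eq)

  ⊆-extend : ∀ {s} e → s ⊆ e ∷ s
  ⊆-extend {s} e = extends preserved
    where
    preserved : ∀ a {b} → lookup s a ≡ just b → lookup (e ∷ s) a ≡ just b
    preserved a eq rewrite eq = refl

  lookup-extend : ∀ s a b → lookup s a ≡ nothing → lookup ((a , b) ∷ s) a ≡ just b
  lookup-extend s a b eq rewrite eq with a ≟ a
  ... | yes _  = refl
  ... | no a≢a = contradiction refl a≢a

  extend-⊆ : ∀ {s s′ a b} → s ⊆ s′ → lookup s′ a ≡ just b → (a , b) ∷ s ⊆ s′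
  extend-⊆ {s} {s′} {a} {b} p eq = extends preserved
    where
    preserved : ∀ c {b′} → lookup ((a , b) ∷ s) c ≡ just b′ → lookup s′ c ≡ just b′
    preserved c h with lookup s c in eqc
    ... | just _ = preserves p c (trans eqc h)
    ... | nothing with c ≟ a
    -- If `c` differs from `a`, then `h` equates `nothing` with a `just`, so only `yes` remains.
    preserved c refl | nothing | yes refl = eq

  -- `a` must be undecided in `s′`, since an older entry would override the new one.
  extend-mono : ∀ {s s′ a b} → s ⊆ s′ → lookup s′ a ≡ nothing →
    (a , b) ∷ s ⊆ (a , b) ∷ s′
  extend-mono {s′ = s′} {a} {b} p eq =
    extend-⊆ (⊆-trans p (⊆-extend (a , b))) (lookup-extend s′ a b eq)

  mem : State → Tree A → Tree A
  mem s T = T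
  mem s F = F
  mem s (X ⊴ a ⊵ Y) with lookup s a
  ... | just true  = mem s X
  ... | just false = mem s Y
  ... | nothing    = mem ((a , true) ∷ s) X ⊴ a ⊵ mem ((a , false) ∷ s) Y

  mem-true : ∀ {s s′ a} X Y → s ⊆ s′ → lookup s a ≡ just true →
    mem s′ (X ⊴ a ⊵ Y) ≡ mem s′ X
  mem-true {a = a} X Y p eq rewrite preserves p a eq = refl

  mem-false : ∀ {s s′ a} X Y → s ⊆ s′ → lookup s a ≡ just false →
    mem s′ (X ⊴ a ⊵ Y) ≡ mem s′ Y
  mem-false {a = a} X Y p eq rewrite preserves p a eq = refl

  -- Links states to `L` and `R`. The oldest entry acts first and removes its atom, so later entries
  -- for that atom have no effect, in agreement with `lookup`.
  restrict : State → Tree A → Tree A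
  restrict []                X = X
  restrict ((a , true) ∷ s)  X = L a (restrict s X)
  restrict ((a , false) ∷ s) X = R a (restrict s X)

  branch : Maybe Bool → A → Tree A → Tree A → Tree A
  branch (just true)  a X Y = X
  branch (just false) a X Y = Y
  branch nothing      a X Y = X ⊴ a ⊵ Y

  restrict-T : ∀ s → restrict s T ≡ T
  restrict-T []                = refl
  restrict-T ((a , true) ∷ s)  = cong (L a) (restrict-T s)
  restrict-T ((a , false) ∷ s) = cong (R a) (restrict-T s)

  restrict-F : ∀ s → restrict s F ≡ F
  restrict-F []                = refl
  restrict-F ((a , true) ∷ s)  = cong (L a) (restrict-F s)
  restrict-F ((a , false) ∷ s) = cong (R a) (restrict-F s)

  restrict-⊴ : ∀ s X a Y →
    restrict s (X ⊴ a ⊵ Y) ≡ branch (lookup s a) a (restrict s X) (restrict s Y)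
  restrict-⊴ [] X a Y = refl
  restrict-⊴ ((c , true) ∷ s) X a Y rewrite restrict-⊴ s X a Y with lookup s a
  ... | just true  = refl
  ... | just false = refl
  ... | nothing with a ≟ c
  ...   | yes _ = refl
  ...   | no _  = refl
  restrict-⊴ ((c , false) ∷ s) X a Y rewrite restrict-⊴ s X a Y with lookup s a
  ... | just true  = refl
  ... | just false = refl
  ... | nothing with a ≟ c
  ...   | yes _ = refl
  ...   | no _  = refl

  -- With the state general, induction on `X` suffices: the `L a` and `R a` that `m-⊴` puts on the
  -- branches become new entries of the state.
  m-restrict : ∀ s X → m (restrict s X) ≡ mem s X
  m-restrict s T = cong m (restrict-T s)
  m-restrict s F = cong m (restrict-F s)
  m-restrict s (X ⊴ a ⊵ Y) rewrite restrict-⊴ s X a Y with lookup s a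
  ... | just true  = m-restrict s X
  ... | just false = m-restrict s Y
  ... | nothing    = trans (m-⊴ (restrict s X) a (restrict s Y))
    (cong₂ (_⊴ a ⊵_) (m-restrict ((a , true) ∷ s) X) (m-restrict ((a , false) ∷ s) Y))

  -- A run from `s` only discards branches that the larger `s′` discards too. This allows a
  -- condition to be replaced by its memorizing form.
  mem-[]-mem : ∀ {s s′} X Y Z → s ⊆ s′ →
    mem s′ (mem s X [T↦ Y ,F↦ Z ]) ≡ mem s′ (X [T↦ Y ,F↦ Z ])
  mem-[]-mem T Y Z p = refl
  mem-[]-mem F Y Z p = refl
  mem-[]-mem {s} {s′} (X₁ ⊴ a ⊵ X₂) Y Z p with lookup s a in eq
  ... | just true  rewrite preserves p a eq = mem-[]-mem X₁ Y Z p
  ... | just false rewrite preserves p a eq = mem-[]-mem X₂ Y Z p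
  ... | nothing with lookup s′ a in eq′
  -- Here `s′` decides an atom that `s` leaves open, so `s` extended by that value still lies below
  -- `s′`.
  ...   | just true  = mem-[]-mem X₁ Y Z (extend-⊆ p eq′)
  ...   | just false = mem-[]-mem X₂ Y Z (extend-⊆ p eq′)
  ...   | nothing    = cong₂ (_⊴ a ⊵_)
    (mem-[]-mem X₁ Y Z (extend-mono p eq′)) (mem-[]-mem X₂ Y Z (extend-mono p eq′))

  mem-mem : ∀ {s s′} X → s ⊆ s′ → mem s′ (mem s X) ≡ mem s′ X
  mem-mem {s} {s′} X p = begin
    mem s′ (mem s X)                  ≡⟨ cong (mem s′) ([]-identity (mem s X)) ⟨
    mem s′ (mem s X [T↦ T ,F↦ F ])    ≡⟨ mem-[]-mem X T F p ⟩
    mem s′ (X [T↦ T ,F↦ F ])          ≡⟨ cong (mem s′) ([]-identity X) ⟩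
    mem s′ X                          ∎
    where open ≡-Reasoning

  -- mem s X ≡ F says that s already determines X to be false; then so does
  -- every larger state.
  mem-[]-F : ∀ {s s′} X Y Z → s ⊆ s′ → mem s X ≡ F →
    mem s′ (X [T↦ Y ,F↦ Z ]) ≡ mem s′ Z
  mem-[]-F {s} {s′} X Y Z p eq = begin
    mem s′ (X [T↦ Y ,F↦ Z ])          ≡⟨ mem-[]-mem X Y Z p ⟨
    mem s′ (mem s X [T↦ Y ,F↦ Z ])    ≡⟨ cong (λ V → mem s′ (V [T↦ Y ,F↦ Z ])) eq ⟩
    mem s′ Z                          ∎
    where open ≡-Reasoning

  -- A leaf of `X` is reached in an extension of `s` that evaluates `X` to this leaf, so the
  -- replacing trees need to agree only in such states.
  mem-[]-cong : ∀ {s} X {Y Y′ Z Z′} →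
    (∀ {s′} → s ⊆ s′ → mem s′ X ≡ T → mem s′ Y ≡ mem s′ Y′) →
    (∀ {s′} → s ⊆ s′ → mem s′ X ≡ F → mem s′ Z ≡ mem s′ Z′) →
    mem s (X [T↦ Y ,F↦ Z ]) ≡ mem s (X [T↦ Y′ ,F↦ Z′ ])
  mem-[]-cong T hT hF = hT ⊆-refl refl
  mem-[]-cong F hT hF = hF ⊆-refl refl
  mem-[]-cong {s} (X₁ ⊴ a ⊵ X₂) hT hF with lookup s a in eq
  ... | just true  = mem-[]-cong X₁
    (λ p e → hT p (trans (mem-true X₁ X₂ p eq) e))
    (λ p e → hF p (trans (mem-true X₁ X₂ p eq) e))
  ... | just false = mem-[]-cong X₂
    (λ p e → hT p (trans (mem-false X₁ X₂ p eq) e))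
    (λ p e → hF p (trans (mem-false X₁ X₂ p eq) e))
  ... | nothing    = cong₂ (_⊴ a ⊵_)
    (mem-[]-cong X₁
      (λ p e → hT (⊆-trans (⊆-extend _) p)
        (trans (mem-true X₁ X₂ p (lookup-extend s a true eq)) e))
      (λ p e → hF (⊆-trans (⊆-extend _) p)
        (trans (mem-true X₁ X₂ p (lookup-extend s a true eq)) e)))
    (mem-[]-cong X₂
      (λ p e → hT (⊆-trans (⊆-extend _) p)
        (trans (mem-false X₁ X₂ p (lookup-extend s a false eq)) e))
      (λ p e → hF (⊆-trans (⊆-extend _) p)
        (trans (mem-false X₁ X₂ p (lookup-extend s a false eq)) e)))

  -- Soundness of the axioms and of equational logic

  sound-axiom : ∀ {t u} → CPₘₑₘ t u → ∀ ρ s → mem s (⟦ t ⟧ ρ) ≡ mem s (⟦ u ⟧ ρ)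
  sound-axiom (cp CP1) ρ s = refl
  sound-axiom (cp CP2) ρ s = refl
  sound-axiom (cp CP3) ρ s = cong (mem s) ([]-identity (ρ 0))
  sound-axiom (cp CP4) ρ s = cong (mem s) ([]-assoc (ρ 2) (ρ 1) (ρ 3) (ρ 0) (ρ 4))
  -- Once `y` has come out false it stays false while `u` is run, so the second test of `y`
  -- continues with `w`.
  sound-axiom CPmem    ρ s = mem-[]-cong (ρ 1) (λ _ _ → refl)
    (λ _ y-false → mem-[]-cong (ρ 3) (λ _ _ → refl)
      (λ p _ → mem-[]-F (ρ 1) (ρ 4) (ρ 5) p y-false))

  -- All states are needed for `≈-cong`, whose outer terms are run where the condition ends; all
  -- valuations are needed for `≈-subst`.
  sound : ∀ {t u} → CPₘₑₘ ⊢ t ≈ u → ∀ ρ s → mem s (⟦ t ⟧ ρ) ≡ mem s (⟦ u ⟧ ρ)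
  sound (axiom e)     ρ s = sound-axiom e ρ s
  sound ≈-refl        ρ s = refl
  sound (≈-sym d)     ρ s = sym (sound d ρ s)
  sound (≈-trans d e) ρ s = trans (sound d ρ s) (sound e ρ s)
  sound (≈-subst {t} {u} σ d) ρ s
    rewrite ⟦⟧-⟪⟫ t σ ρ | ⟦⟧-⟪⟫ u σ ρ = sound d (λ n → ⟦ σ n ⟧ ρ) s
  sound (≈-cong {x} {x′} {y} {y′} {z} {z′} d e f) ρ s = begin
    -- The premise on the condition equates only memorized trees, so `mem s` is first inserted
    -- around `Y`.
    mem s (Y [T↦ X ,F↦ Z ])           ≡⟨ mem-[]-mem Y X Z ⊆-refl ⟨
    mem s (mem s Y [T↦ X ,F↦ Z ])     ≡⟨ cong (λ V → mem s (V [T↦ X ,F↦ Z ])) (sound e ρ s) ⟩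
    mem s (mem s Y′ [T↦ X ,F↦ Z ])    ≡⟨ mem-[]-mem Y′ X Z ⊆-refl ⟩
    mem s (Y′ [T↦ X ,F↦ Z ])          ≡⟨ mem-[]-cong Y′ (λ _ _ → sound d ρ _) (λ _ _ → sound f ρ _) ⟩
    mem s (Y′ [T↦ X′ ,F↦ Z′ ])        ∎
    where
    open ≡-Reasoning
    X = ⟦ x ⟧ ρ
    Y = ⟦ y ⟧ ρ
    Y′ = ⟦ y′ ⟧ ρ
    Z = ⟦ z ⟧ ρ
    X′ = ⟦ x′ ⟧ ρ
    Z′ = ⟦ z′ ⟧ ρ

  mse-sound : (P Q : Closed A) → CPₘₑₘ ⊢ ⌜ P ⌝ ≈ ⌜ Q ⌝ → P =mse Q
  mse-sound P Q d = begin
    m (se P)              ≡⟨ m-restrict [] (se P) ⟩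
    mem [] (se P)         ≡⟨ cong (mem []) (⟦⟧-closed P _ ρ) ⟨
    mem [] (⟦ ⌜ P ⌝ ⟧ ρ)  ≡⟨ sound d ρ [] ⟩
    mem [] (⟦ ⌜ Q ⌝ ⟧ ρ)  ≡⟨ cong (mem []) (⟦⟧-closed Q _ ρ) ⟩
    mem [] (se Q)         ≡⟨ m-restrict [] (se Q) ⟨
    m (se Q)              ∎
    where
    open ≡-Reasoning
    -- Closed terms contain no variables, so any valuation would do.
    ρ : ℕ → Tree A
    ρ _ = T

-- Derivations in CPₘₑₘ

module _ {ℓ} {A : Set ℓ} where

  infix 4 _≈_
  _≈_ : Open A → Open A → Set ℓ
  s ≈ t = CPₘₑₘ ⊢ s ≈ t

  ≈-setoid : Setoid ℓ ℓ
  ≈-setoid = record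
    { Carrier = Open A
    ; _≈_ = _≈_
    ; isEquivalence = record { refl = ≈-refl ; sym = ≈-sym ; trans = ≈-trans }
    }

  open SetoidReasoning ≈-setoid

  ≈-reflexive : ∀ {s t} → s ≡ t → s ≈ t
  ≈-reflexive refl = ≈-refl

  -- Indices follow the numbering of the variables in the axioms; `w` also fills all indices above
  -- 5.
  assign : (x y z u v w : Open A) → ℕ → Open A
  assign x y z u v w 0 = x
  assign x y z u v w 1 = y
  assign x y z u v w 2 = z
  assign x y z u v w 3 = u
  assign x y z u v w 4 = v
  assign x y z u v w _ = w

  ◁T▷ : ∀ x y → x ◁ T ▷ y ≈ x
  ◁T▷ x y = ≈-subst (assign x y T T T T) (axiom (cp CP1))

  ◁F▷ : ∀ x y → x ◁ F ▷ y ≈ y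
  ◁F▷ x y = ≈-subst (assign x y T T T T) (axiom (cp CP2))

  T◁▷F : ∀ x → T ◁ x ▷ F ≈ x
  T◁▷F x = ≈-subst (assign x T T T T T) (axiom (cp CP3))

  ◁▷-distrib : ∀ x y z u v → x ◁ (y ◁ z ▷ u) ▷ v ≈ (x ◁ y ▷ v) ◁ z ▷ (x ◁ u ▷ v)
  ◁▷-distrib x y z u v = ≈-subst (assign x y z u v T) (axiom (cp CP4))

  ◁▷-cong : ∀ {x x′} y {z z′} → x ≈ x′ → z ≈ z′ → x ◁ y ▷ z ≈ x′ ◁ y ▷ z′
  ◁▷-cong y p q = ≈-cong p ≈-refl q

  not : Open A → Open A
  not x = F ◁ x ▷ T

  ◁not▷ : ∀ x y z → x ◁ not y ▷ z ≈ z ◁ y ▷ x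
  ◁not▷ x y z = begin
    x ◁ not y ▷ z                    ≈⟨ ◁▷-distrib x F y T z ⟩
    (x ◁ F ▷ z) ◁ y ▷ (x ◁ T ▷ z)    ≈⟨ ◁▷-cong y (◁F▷ x z) (◁T▷ x z) ⟩
    z ◁ y ▷ x                        ∎

  -- The two letters tell in which branch of the outer `y`, and then of `u`, the inner `y` occurs.
  -- Negating `u` flips the second letter, negating `y` the first.
  mem-FF : ∀ x y z u v w →
    x ◁ y ▷ (z ◁ u ▷ (v ◁ y ▷ w)) ≈ x ◁ y ▷ (z ◁ u ▷ w)
  mem-FF x y z u v w = ≈-subst (assign x y z u v w) (axiom CPmem)

  mem-FT : ∀ x y z u v w →
    x ◁ y ▷ ((v ◁ y ▷ w) ◁ u ▷ z) ≈ x ◁ y ▷ (w ◁ u ▷ z)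
  mem-FT x y z u v w = begin
    x ◁ y ▷ ((v ◁ y ▷ w) ◁ u ▷ z)        ≈⟨ ◁▷-cong y ≈-refl (◁not▷ z u (v ◁ y ▷ w)) ⟨
    x ◁ y ▷ (z ◁ not u ▷ (v ◁ y ▷ w))    ≈⟨ mem-FF x y z (not u) v w ⟩
    x ◁ y ▷ (z ◁ not u ▷ w)              ≈⟨ ◁▷-cong y ≈-refl (◁not▷ z u w) ⟩
    x ◁ y ▷ (w ◁ u ▷ z)                  ∎

  mem-TF : ∀ x y z u v w →
    (z ◁ u ▷ (w ◁ y ▷ v)) ◁ y ▷ x ≈ (z ◁ u ▷ w) ◁ y ▷ x
  mem-TF x y z u v w = begin
    (z ◁ u ▷ (w ◁ y ▷ v)) ◁ y ▷ x          ≈⟨ ◁▷-cong y (◁▷-cong u ≈-refl (◁not▷ v y w)) ≈-refl ⟨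
    (z ◁ u ▷ (v ◁ not y ▷ w)) ◁ y ▷ x      ≈⟨ ◁not▷ x y _ ⟨
    x ◁ not y ▷ (z ◁ u ▷ (v ◁ not y ▷ w))  ≈⟨ mem-FF x (not y) z u v w ⟩
    x ◁ not y ▷ (z ◁ u ▷ w)                ≈⟨ ◁not▷ x y _ ⟩
    (z ◁ u ▷ w) ◁ y ▷ x                    ∎

  mem-TT : ∀ x y z u v w →
    ((w ◁ y ▷ v) ◁ u ▷ z) ◁ y ▷ x ≈ (w ◁ u ▷ z) ◁ y ▷ x
  mem-TT x y z u v w = begin
    ((w ◁ y ▷ v) ◁ u ▷ z) ◁ y ▷ x        ≈⟨ ◁▷-cong y (◁not▷ z u (w ◁ y ▷ v)) ≈-refl ⟨
    (z ◁ not u ▷ (w ◁ y ▷ v)) ◁ y ▷ x    ≈⟨ mem-TF x y z (not u) v w ⟩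
    (z ◁ not u ▷ w) ◁ y ▷ x              ≈⟨ ◁▷-cong y (◁not▷ z u w) ≈-refl ⟩
    (w ◁ u ▷ z) ◁ y ▷ x                  ∎

  contract-F : ∀ x y v w → x ◁ y ▷ (v ◁ y ▷ w) ≈ x ◁ y ▷ w
  contract-F x y v w = begin
    -- CPmem expects a conditional between the two tests of `y`; one with condition `F` is inserted
    -- and removed again.
    x ◁ y ▷ (v ◁ y ▷ w)              ≈⟨ ◁▷-cong y ≈-refl (◁F▷ T _) ⟨
    x ◁ y ▷ (T ◁ F ▷ (v ◁ y ▷ w))    ≈⟨ mem-FF x y T F v w ⟩
    x ◁ y ▷ (T ◁ F ▷ w)              ≈⟨ ◁▷-cong y ≈-refl (◁F▷ T w) ⟩
    x ◁ y ▷ w                        ∎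

  contract-T : ∀ x y v w → (w ◁ y ▷ v) ◁ y ▷ x ≈ w ◁ y ▷ x
  contract-T x y v w = begin
    (w ◁ y ▷ v) ◁ y ▷ x              ≈⟨ ◁▷-cong y (◁F▷ T _) ≈-refl ⟨
    (T ◁ F ▷ (w ◁ y ▷ v)) ◁ y ▷ x    ≈⟨ mem-TF x y T F v w ⟩
    (T ◁ F ▷ w) ◁ y ▷ x              ≈⟨ ◁▷-cong y (◁F▷ T w) ≈-refl ⟩
    w ◁ y ▷ x                        ∎

  -- Carries rewriting in the true branch of `y` past a test of `u`: CPmem plants a copy of `y`
  -- directly above `x` or `z`, the hypothesis acts there, and the copy is dropped. The argument `T`
  -- is an arbitrary filler.
  under-T : ∀ {x x′ z z′} u y w → (∀ v → x ◁ y ▷ v ≈ x′ ◁ y ▷ v) →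
    (∀ v → z ◁ y ▷ v ≈ z′ ◁ y ▷ v) → (x ◁ u ▷ z) ◁ y ▷ w ≈ (x′ ◁ u ▷ z′) ◁ y ▷ w
  under-T {x} {x′} {z} {z′} u y w p q = begin
    (x ◁ u ▷ z) ◁ y ▷ w                ≈⟨ mem-TT w y z u T x ⟨
    ((x ◁ y ▷ T) ◁ u ▷ z) ◁ y ▷ w      ≈⟨ ◁▷-cong y (◁▷-cong u (p T) ≈-refl) ≈-refl ⟩
    ((x′ ◁ y ▷ T) ◁ u ▷ z) ◁ y ▷ w     ≈⟨ mem-TT w y z u T x′ ⟩
    (x′ ◁ u ▷ z) ◁ y ▷ w               ≈⟨ mem-TF w y x′ u T z ⟨
    (x′ ◁ u ▷ (z ◁ y ▷ T)) ◁ y ▷ w     ≈⟨ ◁▷-cong y (◁▷-cong u ≈-refl (q T)) ≈-refl ⟩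
    (x′ ◁ u ▷ (z′ ◁ y ▷ T)) ◁ y ▷ w    ≈⟨ mem-TF w y x′ u T z′ ⟩
    (x′ ◁ u ▷ z′) ◁ y ▷ w              ∎

  under-F : ∀ {x x′ z z′} u y w → (∀ v → v ◁ y ▷ x ≈ v ◁ y ▷ x′) →
    (∀ v → v ◁ y ▷ z ≈ v ◁ y ▷ z′) → w ◁ y ▷ (x ◁ u ▷ z) ≈ w ◁ y ▷ (x′ ◁ u ▷ z′)
  under-F {x} {x′} {z} {z′} u y w p q = begin
    w ◁ y ▷ (x ◁ u ▷ z)                ≈⟨ mem-FT w y z u T x ⟨
    w ◁ y ▷ ((T ◁ y ▷ x) ◁ u ▷ z)      ≈⟨ ◁▷-cong y ≈-refl (◁▷-cong u (p T) ≈-refl) ⟩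
    w ◁ y ▷ ((T ◁ y ▷ x′) ◁ u ▷ z)     ≈⟨ mem-FT w y z u T x′ ⟩
    w ◁ y ▷ (x′ ◁ u ▷ z)               ≈⟨ mem-FF w y x′ u T z ⟨
    w ◁ y ▷ (x′ ◁ u ▷ (T ◁ y ▷ z))     ≈⟨ ◁▷-cong y ≈-refl (◁▷-cong u ≈-refl (q T)) ⟩
    w ◁ y ▷ (x′ ◁ u ▷ (T ◁ y ▷ z′))    ≈⟨ mem-FF w y x′ u T z′ ⟩
    w ◁ y ▷ (x′ ◁ u ▷ z′)              ∎

  -- Trees read as basic forms, the terms in which every condition is an atom.
  term : Tree A → Open A
  term T           = T
  term F           = F
  term (X ⊴ a ⊵ Y) = term X ◁ atom a ▷ term Y

  term-[] : ∀ X Y Z → term (X [T↦ Y ,F↦ Z ]) ≈ term Y ◁ term X ▷ term Z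
  term-[] T Y Z = ≈-sym (◁T▷ _ _)
  term-[] F Y Z = ≈-sym (◁F▷ _ _)
  term-[] (X₁ ⊴ a ⊵ X₂) Y Z = ≈-trans
    (◁▷-cong (atom a) (term-[] X₁ Y Z) (term-[] X₂ Y Z))
    (≈-sym (◁▷-distrib _ _ _ _ _))

  -- By CP4, through `term-[]`, the branches move to the leaves of the condition. `σ` is arbitrary
  -- for the same reason as in `⟦⟧-closed`.
  term-se : (P : Closed A) (σ : ⊥ → Open A) → P ⟪ σ ⟫ ≈ term (se P)
  term-se T           σ = ≈-refl
  term-se F           σ = ≈-refl
  term-se (atom a)    σ = ≈-sym (T◁▷F (atom a))
  term-se (P ◁ Q ▷ R) σ = ≈-trans (≈-cong (term-se P σ) (term-se Q σ) (term-se R σ))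
    (≈-sym (term-[] (se Q) (se P) (se R)))

-- Completeness: derivable reduction to memorizing trees

module Completeness {ℓ} {A : Set ℓ} (_≟_ : DecidableEquality A) where
  open Memorizing _≟_

  -- A repeated test of `a` at the root is contracted; past any other root, `under-T` carries both
  -- induction hypotheses, which is why `z` is arbitrary.
  term-L : ∀ a X z → term X ◁ atom a ▷ z ≈ term (L a X) ◁ atom a ▷ z
  term-L a T z = ≈-refl
  term-L a F z = ≈-refl
  term-L a (X ⊴ b ⊵ Y) z with b ≟ a
  ... | yes refl = ≈-trans (contract-T z (atom b) (term Y) (term X)) (term-L b X z)
  ... | no _     = under-T (atom b) (atom a) z (term-L a X) (term-L a Y)

  term-R : ∀ a Y z → z ◁ atom a ▷ term Y ≈ z ◁ atom a ▷ term (R a Y)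
  term-R a T z = ≈-refl
  term-R a F z = ≈-refl
  term-R a (X ⊴ b ⊵ Y) z with b ≟ a
  ... | yes refl = ≈-trans (contract-F z (atom b) (term X) (term Y)) (term-R b Y z)
  ... | no _     = under-F (atom b) (atom a) z (term-R a X) (term-R a Y)

  -- Follows the recursion of `mAcc`: each branch is pruned in the presence of the other, then both
  -- are normalized.
  term-mAcc : ∀ X (p : Acc _<_ (depth X)) → term X ≈ term (mAcc X p)
  term-mAcc T _ = ≈-refl
  term-mAcc F _ = ≈-refl
  term-mAcc (X ⊴ a ⊵ Y) (acc rs) =
    ≈-trans (term-L a X (term Y))
      (≈-trans (term-R a Y (term (L a X)))
        (◁▷-cong (atom a) (term-mAcc (L a X) (rs (L-< X a Y)))
                          (term-mAcc (R a Y) (rs (R-< X a Y)))))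

  term-mse : (P : Closed A) → ⌜ P ⌝ ≈ term (mse P)
  term-mse P = ≈-trans (term-se P _) (term-mAcc (se P) (<-wellFounded _))

  mse-complete : (P Q : Closed A) → P =mse Q → CPₘₑₘ ⊢ ⌜ P ⌝ ≈ ⌜ Q ⌝
  mse-complete P Q eq =
    ≈-trans (term-mse P) (≈-trans (≈-reflexive (cong term eq)) (≈-sym (term-mse Q)))

theorem5p14 : ∀ {ℓ} {A : Set ℓ} (countable : A ↣ ℕ) → (∃₂ λ (a b : A) → a ≢ b) →
    let open Memorizing (eq? countable) in
    (P Q : Closed A) → (CPₘₑₘ ⊢ ⌜ P ⌝ ≈ ⌜ Q ⌝) ⇔ (P =mse Q)
theorem5p14 countable _ P Q =
  mk⇔ (State.mse-sound (eq? countable) P Q) (Completeness.mse-complete (eq? countable) P Q)
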